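{- For integers $k \geq 3$ and $n \geq 6$, $$ gr_{k}(K_{3} : W_{n}) \leq (n - 4)^{2} \cdot 30^{k} + k(n - 1). $$
   Context: For $n \geq 4$, the wheel $W_n$ is the graph of order $n$ given by $W_n = K_1 \vee C_{n-1}$, i.e., a cycle on $n-1$ vertices together with one additional vertex adjacent to all vertices of the cycle. For graphs $G$, $H$ and a positive integer $k$, the Gallai-Ramsey number $gr_k(G:H)$ is the minimum integer $m$ such that every coloring of the edges of $K_m$ using at most $k$ colors contains either a rainbow copy of $G$ (all edges receiving distinct colors) or a monochromatic copy of $H$. -}

module Defs where

open import Data.Nat using (ℕ; zero; suc; _+_; _*_; _∸_; _^_; _≤_)
open import Data.Fin using (Fin; toℕ)
open import Data.Product using (_×_; ∃; Σ)
open import Data.Sum using (_⊎_)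
open import Relation.Binary.PropositionalEquality using (_≡_; _≢_)
open import Function.Definitions using (Injective)

-- An edge-colouring of the complete graph K_m (vertex set Fin m) using at
-- most k colours (colour set Fin k).  Only values on distinct pairs matter;
-- symmetry makes it a colouring of undirected edges.
record Colouring (m k : ℕ) : Set where
  field
    col  : Fin m → Fin m → Fin k
    symm : ∀ i j → col i j ≡ col j i
open Colouring public

RainbowK3 : ∀ {m k} → Colouring m k → Set
RainbowK3 {m} c = ∃ λ (a : Fin m) → ∃ λ (b : Fin m) → ∃ λ (d : Fin m) →
  (a ≢ b) × (b ≢ d) × (a ≢ d) ×
  (col c a b ≢ col c b d) × (col c a b ≢ col c a d) × (col c b d ≢ col c a d)

-- The wheel W_n on vertex set {0,…,n-1}: vertex 0 is the hub, adjacent to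
-- every other vertex; vertices 1,…,n-1 form the cycle
-- 1 - 2 - … - (n-1) - 1.  Each undirected edge is listed (at least) once.
WheelEdge : ℕ → ℕ → ℕ → Set
WheelEdge n a b =
  (a ≡ 0 × 1 ≤ b) ⊎ ((1 ≤ a × b ≡ suc a) ⊎ (a ≡ n ∸ 1 × b ≡ 1))

MonoWheel : ∀ {m k} → ℕ → Colouring m k → Set
MonoWheel {m} {k} n c =
  Σ (Fin n → Fin m) λ f → Injective _≡_ _≡_ f × ∃ λ (κ : Fin k) →
    ∀ (u v : Fin n) → WheelEdge n (toℕ u) (toℕ v) → col c (f u) (f v) ≡ κ

GRProperty : ℕ → ℕ → ℕ → Set
GRProperty k n m = (c : Colouring m k) → RainbowK3 c ⊎ MonoWheel n c

-- gr_k(K_3 : W_n) ≤ N, i.e. the property holds for every m ≥ N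
-- (the minimum such m is at most N).
GR-K3-Wheel-≤ : ℕ → ℕ → ℕ → Set
GR-K3-Wheel-≤ k n N = ∀ m → N ≤ m → GRProperty k n m

{-# OPTIONS --safe #-}

-- Put d = n − 4 and q = n − 2.  The wheel W_n is contained in the fan K₂ ∨ P_q, so
-- assume that there is neither a rainbow triangle nor a monochromatic fan.  To a vertex
-- set P attach, for each colour i, two sets X and Y that are joined in colour i to each
-- other and to P.  Once both have q elements, P has no edge of colour i, for such an edge
-- would be joined to an alternating path in X ∪ Y.  With L the number of attached sets
-- that are still shorter than q, and T the number of elements that these sets still lack,
-- one has |P| ≤ 36 d² · 3^L + T, by induction on |P|.
--
-- Take a Gallai partition of P, with colours a and b between the parts.  If a part W has
-- at least q vertices, then P is W together with its a- and b-neighbourhoods N_a and N_b.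
-- Adding N_a and N_b to the sets attached to W, and W to those attached to N_a and N_b,
-- lowers L or T; the factor 3 works because 1/9 + 1/3 + 1/3 < 1.  If every part is small,
-- choose vertices v₁, v₂, v₃, each in the larger neighbourhood of the previous ones.  Two
-- of them see the remaining set in the same colour, which therefore has no path P_q there;
-- so that colour is degenerate, and the other colour contains a clique K_n.
--
-- For P the whole vertex set, L = 2k and T = 2kq, and 36 d² · 9^k + 2kq is less than the
-- claimed bound because 37 · 9^k ≤ 30^k for k ≥ 3.

module Submission where

open import Defs
open import Data.Nat using (ℕ; zero; suc; _+_; _*_; _∸_; _^_; _≤_; _<_; z≤n; s≤s; _≤?_; _<?_)
open import Data.Nat.Properties hiding (_≟_)
open import Data.Bool using (Bool; true; false; if_then_else_; _∧_)
open import Data.Fin using (Fin; zero; suc; toℕ; _≟_)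
import Data.Fin.Properties as Fin
open import Data.List using (List; []; _∷_; _++_; length; filter; lookup; allFin)
open import Data.List.Properties using (length-++; filter-notAll; length-tabulate)
open import Data.List.Membership.Propositional using (_∈_; find; lose)
open import Data.List.Membership.Propositional.Properties using (∈-∃++; ∈-++⁻; ∈-++⁺ˡ; ∈-++⁺ʳ; ∈-filter⁺; ∈-filter⁻)
open import Data.List.Relation.Unary.Any using (Any; here; there; any?)
open import Data.List.Relation.Unary.All as All using (All; []; _∷_)
open import Data.List.Relation.Unary.AllPairs as AllPairs using (AllPairs; []; _∷_; allPairs?)
open import Data.List.Relation.Unary.Linked using (Linked; []; [-]; _∷_; linked?)
open import Data.List.Relation.Unary.Linked.Properties using (AllPairs⇒Linked)
open import Data.List.Relation.Unary.Unique.Propositional using (Unique)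
open import Data.List.Relation.Unary.Unique.Propositional.Properties using (filter⁺; ++⁺; allFin⁺)
open import Algebra.Properties.CommutativeMonoid.Sum +-0-commutativeMonoid using (sum; sum-cong-≗)
open import Data.Nat.Tactic.RingSolver using (solve-∀)
open import Data.Product using (_×_; _,_; ∃; proj₁; proj₂)
open import Data.Sum using (_⊎_; inj₁; inj₂)
open import Data.Empty using (⊥; ⊥-elim)
open import Function using (_∘_)
open import Level using (0ℓ)
open import Relation.Nullary using (¬_; Dec; yes; no; does; contradiction; ¬?)
open import Relation.Nullary.Decidable using (from-yes; dec-true; dec-false; _×-dec_; _⊎-dec_)
open import Relation.Unary using (Pred; Decidable)
import Relation.Binary as B
open import Relation.Binary.PropositionalEquality using (_≡_; _≢_; refl; sym; trans; cong; cong₂; subst; module ≡-Reasoning)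

-- Counting in duplicate-free lists, and sums over the colours.

module _ {A : Set} where

  unique-⊆⇒length≤ : {xs ys : List A} → Unique xs → (∀ {x} → x ∈ xs → x ∈ ys) →
                     length xs ≤ length ys
  unique-⊆⇒length≤ {[]} _ _ = z≤n
  unique-⊆⇒length≤ {x ∷ xs} (x∉xs ∷ xs!) xs⊆ys with ∈-∃++ (xs⊆ys (here refl))
  ... | as , bs , refl = begin
    suc (length xs)             ≤⟨ s≤s (unique-⊆⇒length≤ xs! xs⊆as++bs) ⟩
    suc (length (as ++ bs))     ≡⟨ cong suc (length-++ as) ⟩
    suc (length as + length bs) ≡⟨ sym (+-suc (length as) (length bs)) ⟩
    length as + suc (length bs) ≡⟨ sym (length-++ as) ⟩
    length (as ++ x ∷ bs)       ∎
    where
    open ≤-Reasoning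
    xs⊆as++bs : ∀ {y} → y ∈ xs → y ∈ as ++ bs
    xs⊆as++bs y∈xs with ∈-++⁻ as (xs⊆ys (there y∈xs))
    ... | inj₁ y∈as         = ∈-++⁺ˡ y∈as
    ... | inj₂ (here y≡x)   = contradiction (sym y≡x) (All.lookup x∉xs y∈xs)
    ... | inj₂ (there y∈bs) = ∈-++⁺ʳ as y∈bs

  length≤-cover : {P Q R : Pred A 0ℓ} (P? : Decidable P) (Q? : Decidable Q) (R? : Decidable R) →
                  {xs : List A} → Unique xs → (∀ {x} → x ∈ xs → P x ⊎ Q x ⊎ R x) →
                  length xs ≤ length (filter P? xs) + (length (filter Q? xs) + length (filter R? xs))
  length≤-cover {P} {Q} {R} P? Q? R? {xs} xs! cover = begin
    length xs                                           ≤⟨ unique-⊆⇒length≤ xs! covered ⟩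
    length (ps ++ (qs ++ rs))                           ≡⟨ length-++ ps ⟩
    length ps + length (qs ++ rs)                       ≡⟨ cong (length ps +_) (length-++ qs) ⟩
    length ps + (length qs + length rs)                 ∎
    where
    open ≤-Reasoning
    ps = filter P? xs
    qs = filter Q? xs
    rs = filter R? xs
    covered : ∀ {x} → x ∈ xs → x ∈ ps ++ (qs ++ rs)
    covered x∈xs with cover x∈xs
    ... | inj₁ px        = ∈-++⁺ˡ (∈-filter⁺ P? x∈xs px)
    ... | inj₂ (inj₁ qx) = ∈-++⁺ʳ ps (∈-++⁺ˡ (∈-filter⁺ Q? x∈xs qx))
    ... | inj₂ (inj₂ rx) = ∈-++⁺ʳ ps (∈-++⁺ʳ qs (∈-filter⁺ R? x∈xs rx))

-- Cross-addition avoids truncated subtraction; this computes how replacing one reserve affects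
-- `Level` and `Room`.
sum-change : ∀ {k} (f g : Fin k → ℕ) i → (∀ j → i ≢ j → f j ≡ g j) → sum f + g i ≡ sum g + f i
sum-change f g zero eq rewrite sum-cong-≗ (λ j → eq (suc j) λ ()) = lemma (f zero) _ (g zero)
  where
  lemma : ∀ x s y → x + s + y ≡ y + s + x
  lemma = solve-∀
sum-change f g (suc i) eq = begin
  f zero + sum (f ∘ suc) + g (suc i)   ≡⟨ +-assoc (f zero) _ _ ⟩
  f zero + (sum (f ∘ suc) + g (suc i)) ≡⟨ cong₂ _+_ (eq zero λ ()) (sum-change (f ∘ suc) (g ∘ suc) i eq′) ⟩
  g zero + (sum (g ∘ suc) + f (suc i)) ≡⟨ sym (+-assoc (g zero) _ _) ⟩
  g zero + sum (g ∘ suc) + f (suc i)   ∎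
  where
  open ≡-Reasoning
  eq′ : ∀ j → i ≢ j → f (suc j) ≡ g (suc j)
  eq′ j ne = eq (suc j) (ne ∘ Fin.suc-injective)

≤-sum : ∀ {k} (f : Fin k → ℕ) i → f i ≤ sum f
≤-sum f zero    = m≤m+n (f zero) _
≤-sum f (suc i) = ≤-trans (≤-sum (f ∘ suc) i) (m≤n+m _ (f zero))

sum-const : ∀ k x → sum {k} (λ _ → x) ≡ k * x
sum-const zero    x = refl
sum-const (suc k) x = cong (x +_) (sum-const k x)

-- Connected components

-- lab x is the name of the component of x in the graph H on the vertices P.
-- Connectedness is expressed by "every 2-colouring respecting H is constant".
record Labelling {m : ℕ} (H : Fin m → Fin m → Set) (P : List (Fin m)) : Set where
  field
    lab       : Fin m → Fin m
    closed    : ∀ {x} → x ∈ P → lab x ∈ P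
    joins     : ∀ {x y} → x ∈ P → y ∈ P → H x y → lab x ≡ lab y
    connected : ∀ {x y} → x ∈ P → y ∈ P → lab x ≡ lab y → (f : Fin m → Bool) →
                (∀ {u w} → u ∈ P → w ∈ P → H u w → f u ≡ f w) → f x ≡ f y

module _ {m : ℕ} {H : Fin m → Fin m → Set} (H? : B.Decidable H) (H-sym : B.Symmetric H) where

  -- Adding `v` merges all components that contain an `H`-neighbour of `v`. The merged component is
  -- named `v`; every other one keeps its name.
  module AddVertex (v : Fin m) (P : List (Fin m)) (v∉P : All (v ≢_) P) (L : Labelling H P) where
    open Labelling L

    Touched : Fin m → Set
    Touched y = y ≡ v ⊎ Any (λ z → H v z × lab z ≡ lab y) P

    touched? : ∀ y → Dec (Touched y)
    touched? y = (y ≟ v) ⊎-dec any? (λ z → H? v z ×-dec (lab z ≟ lab y)) P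

    lab⁺ : Fin m → Fin m
    lab⁺ y = if does (touched? y) then v else lab y

    lab⁺-touched : ∀ {y} → Touched y → lab⁺ y ≡ v
    lab⁺-touched {y} t rewrite dec-true (touched? y) t = refl

    lab⁺-untouched : ∀ {y} → ¬ Touched y → lab⁺ y ≡ lab y
    lab⁺-untouched {y} t rewrite dec-false (touched? y) t = refl

    old : ∀ {y} → y ∈ v ∷ P → ¬ Touched y → y ∈ P
    old (here y≡v)  t = contradiction (inj₁ y≡v) t
    old (there y∈P) _ = y∈P

    spread : ∀ {x y} → x ∈ v ∷ P → y ∈ v ∷ P → H x y → Touched x → Touched y
    spread _ (here y≡v) _ _ = inj₁ y≡v
    spread _ (there y∈P) h (inj₁ refl) = inj₂ (lose y∈P (h , refl))
    spread (here refl) (there y∈P) h (inj₂ _) = inj₂ (lose y∈P (h , refl))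
    spread (there x∈P) (there y∈P) h (inj₂ t) with find t
    ... | z , z∈P , hz , eq = inj₂ (lose z∈P (hz , trans eq (joins x∈P y∈P h)))

    closed⁺ : ∀ {x} → x ∈ v ∷ P → lab⁺ x ∈ v ∷ P
    closed⁺ {x} x∈ with touched? x
    ... | yes t = subst (_∈ v ∷ P) (sym (lab⁺-touched t)) (here refl)
    ... | no  t = subst (_∈ v ∷ P) (sym (lab⁺-untouched t)) (there (closed (old x∈ t)))

    joins⁺ : ∀ {x y} → x ∈ v ∷ P → y ∈ v ∷ P → H x y → lab⁺ x ≡ lab⁺ y
    joins⁺ {x} {y} x∈ y∈ h = by (touched? x) (touched? y)
      where
      by : Dec (Touched x) → Dec (Touched y) → lab⁺ x ≡ lab⁺ y
      by (yes s) _       = trans (lab⁺-touched s) (sym (lab⁺-touched (spread x∈ y∈ h s)))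
      by (no s)  (yes t) = contradiction (spread y∈ x∈ (H-sym h) t) s
      by (no s)  (no t)  = trans (lab⁺-untouched s)
        (trans (joins (old x∈ s) (old y∈ t) h) (sym (lab⁺-untouched t)))

    connected⁺ : ∀ {x y} → x ∈ v ∷ P → y ∈ v ∷ P → lab⁺ x ≡ lab⁺ y → (f : Fin m → Bool) →
                 (∀ {u w} → u ∈ v ∷ P → w ∈ v ∷ P → H u w → f u ≡ f w) → f x ≡ f y
    connected⁺ {x} {y} x∈ y∈ eq f resp = by (touched? x) (touched? y)
      where
      resp-P : ∀ {u w} → u ∈ P → w ∈ P → H u w → f u ≡ f w
      resp-P u∈ w∈ = resp (there u∈) (there w∈)

      constant : ∀ {u} → u ∈ v ∷ P → Touched u → f u ≡ f v
      constant _ (inj₁ refl) = refl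
      constant (here refl) _ = refl
      constant (there u∈P) (inj₂ t) with find t
      ... | z , z∈P , hz , lab-eq =
        trans (sym (connected z∈P u∈P lab-eq f resp-P)) (sym (resp (here refl) (there z∈P) hz))

      -- Here `closed` matters: old names lie in `P`, so none of them clashes with the new name `v`.
      separate : ∀ {u w} → w ∈ v ∷ P → Touched u → ¬ Touched w → lab⁺ u ≢ lab⁺ w
      separate w∈ s t e = All.lookup v∉P (closed (old w∈ t))
        (trans (sym (lab⁺-touched s)) (trans e (lab⁺-untouched t)))

      by : Dec (Touched x) → Dec (Touched y) → f x ≡ f y
      by (yes s) (yes t) = trans (constant x∈ s) (sym (constant y∈ t))
      by (yes s) (no t)  = contradiction eq (separate y∈ s t)
      by (no s)  (yes t) = contradiction (sym eq) (separate x∈ t s)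
      by (no s)  (no t)  = connected (old x∈ s) (old y∈ t)
        (trans (sym (lab⁺-untouched s)) (trans eq (lab⁺-untouched t))) f resp-P

  labelling : ∀ P → Unique P → Labelling H P
  labelling [] _ = record { lab = λ x → x ; closed = λ () ; joins = λ () ; connected = λ () }
  labelling (v ∷ P) (v∉P ∷ P!) = record
    { lab = lab⁺ ; closed = closed⁺ ; joins = joins⁺ ; connected = connected⁺ }
    where open AddVertex v P v∉P (labelling P P!)

-- Fans

Edge : ∀ {m k} → Colouring m k → Fin k → Fin m → Fin m → Set
Edge c i x y = x ≢ y × col c x y ≡ i

edge? : ∀ {m k} (c : Colouring m k) i → B.Decidable (Edge c i)
edge? c i x y = ¬? (x ≟ y) ×-dec (col c x y ≟ i)

-- A monochromatic K₂ ∨ P_q: the edge xy is joined to the path ys.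
IsFan : ∀ {m k} → Colouring m k → Fin k → Fin m → Fin m → List (Fin m) → Set
IsFan c i x y ys =
  Edge c i x y × All (Edge c i x) ys × All (Edge c i y) ys × Linked (Edge c i) ys × Unique ys

Fan : ∀ {m k} → Colouring m k → ℕ → Set
Fan c q = ∃ λ i → ∃ λ x → ∃ λ y → ∃ λ ys → length ys ≡ q × IsFan c i x y ys

-- Only finitely many lists over `Fin m` have a given length, so `Fan` is decidable and the final
-- proof can branch on it.
∃-list? : ∀ {m} q {P : List (Fin m) → Set} → (∀ ys → Dec (P ys)) →
          Dec (∃ λ ys → length ys ≡ q × P ys)
∃-list? zero P? with P? []
... | yes p = yes ([] , refl , p)
... | no ¬p = no λ { ([] , _ , p) → ¬p p }
∃-list? (suc q) P? with Fin.any? (λ x → ∃-list? q (λ ys → P? (x ∷ ys)))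
... | yes (x , ys , len , p) = yes (x ∷ ys , cong suc len , p)
... | no ¬p = no λ { (x ∷ ys , len , p) → ¬p (x , ys , suc-injective len , p) }

fan? : ∀ {m k} (c : Colouring m k) q → Dec (Fan c q)
fan? c q = Fin.any? λ i → Fin.any? λ x → Fin.any? λ y → ∃-list? q λ ys →
  edge? c i x y ×-dec (All.all? (edge? c i x) ys ×-dec (All.all? (edge? c i y) ys ×-dec
    (linked? (edge? c i) ys ×-dec allPairs? (λ u w → ¬? (u ≟ w)) ys)))

linked-lookup : {A : Set} {R : A → A → Set} {xs : List A} → Linked R xs →
                ∀ i j → toℕ j ≡ suc (toℕ i) → R (lookup xs i) (lookup xs j)
linked-lookup (r ∷ _)  zero    (suc zero)    _ = r
linked-lookup (_ ∷ rs) (suc i) (suc j)       e = linked-lookup rs i j (suc-injective e)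

all-lookup : {A : Set} {P : A → Set} {xs : List A} → All P xs → ∀ i → P (lookup xs i)
all-lookup (p ∷ _)  zero    = p
all-lookup (_ ∷ ps) (suc i) = all-lookup ps i

unique-lookup-injective : {A : Set} {xs : List A} → Unique xs → ∀ i j →
                          lookup xs i ≡ lookup xs j → i ≡ j
unique-lookup-injective (_ ∷ _)   zero    zero    _ = refl
unique-lookup-injective (x∉ ∷ _)  zero    (suc j) e = contradiction e (all-lookup x∉ j)
unique-lookup-injective (x∉ ∷ _)  (suc i) zero    e = contradiction (sym e) (all-lookup x∉ i)
unique-lookup-injective (_ ∷ xs!) (suc i) (suc j) e = cong suc (unique-lookup-injective xs! i j e)

-- The vertex `x` is the hub. The rim runs through `y` and then along the path, and it closes
-- because the last vertex of the path is also joined to `y`.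
fan⇒wheel : ∀ {m k q} (c : Colouring m k) → 1 ≤ q → Fan c q → MonoWheel (2 + q) c
fan⇒wheel {m} c 1≤q (i , x , y , ys , refl , (x≢y , xy) , x-ys , y-ys , path , ys!) =
  f , (λ {u} {v} → f-inj u v) , i , edge
  where
  f : Fin (2 + length ys) → Fin m
  f zero          = x
  f (suc zero)    = y
  f (suc (suc j)) = lookup ys j

  f-inj : ∀ u v → f u ≡ f v → u ≡ v
  f-inj zero          zero          _ = refl
  f-inj zero          (suc zero)    e = contradiction e x≢y
  f-inj zero          (suc (suc j)) e = contradiction e (proj₁ (all-lookup x-ys j))
  f-inj (suc zero)    zero          e = contradiction (sym e) x≢y
  f-inj (suc zero)    (suc zero)    _ = refl
  f-inj (suc zero)    (suc (suc j)) e = contradiction e (proj₁ (all-lookup y-ys j))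
  f-inj (suc (suc j)) zero          e = contradiction (sym e) (proj₁ (all-lookup x-ys j))
  f-inj (suc (suc j)) (suc zero)    e = contradiction (sym e) (proj₁ (all-lookup y-ys j))
  f-inj (suc (suc j)) (suc (suc l)) e with unique-lookup-injective ys! j l e
  ... | refl = refl

  edge : ∀ u v → WheelEdge (2 + length ys) (toℕ u) (toℕ v) → col c (f u) (f v) ≡ i
  edge zero (suc zero)    (inj₁ _) = xy
  edge zero (suc (suc j)) (inj₁ _) = proj₂ (all-lookup x-ys j)
  edge zero _ (inj₂ (inj₁ (() , _)))
  edge zero _ (inj₂ (inj₂ (() , _)))
  edge (suc zero) (suc (suc j)) (inj₂ (inj₁ _)) = proj₂ (all-lookup y-ys j)
  edge (suc (suc j)) (suc (suc l)) (inj₂ (inj₁ (_ , e))) =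
    proj₂ (linked-lookup path j l (suc-injective (suc-injective e)))
  -- With an empty path the closing rim edge would be a loop at `y`.
  edge (suc zero) (suc zero) (inj₂ (inj₂ (e , _))) =
    contradiction (subst (1 ≤_) (sym (suc-injective e)) 1≤q) λ ()
  edge (suc (suc j)) (suc zero) (inj₂ (inj₂ _)) =
    trans (symm c (lookup ys j) y) (proj₂ (all-lookup y-ys j))

-- Gallai partitions

module Gallai {m k : ℕ} (c : Colouring m k) (noRainbow : ¬ RainbowK3 c) where

  V : Set
  V = Fin m

  C : V → V → Fin k
  C = col c

  C-sym : ∀ x y → C x y ≡ C y x
  C-sym = symm c

  triangle : ∀ {x y z} → x ≢ y → x ≢ z → y ≢ z → C x y ≢ C x z →
             C y z ≡ C x y ⊎ C y z ≡ C x z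
  triangle {x} {y} {z} x≢y x≢z y≢z ne with C x y ≟ C y z | C y z ≟ C x z
  ... | yes p | _     = inj₁ (sym p)
  ... | no _  | yes q = inj₂ q
  ... | no p  | no q  = contradiction (x , y , z , x≢y , y≢z , x≢z , p , ne , q) noRainbow

  -- Components of this graph become the parts of a Gallai partition: an edge between two of them
  -- can only have colour `a` or `b`.
  Off : Fin k → Fin k → V → V → Set
  Off a b x y = x ≢ y × C x y ≢ a × C x y ≢ b

  off? : ∀ a b → B.Decidable (Off a b)
  off? a b x y = ¬? (x ≟ y) ×-dec (¬? (C x y ≟ a) ×-dec ¬? (C x y ≟ b))

  off-sym : ∀ {a b} → B.Symmetric (Off a b)
  off-sym {x = x} {y} (x≢y , ≢a , ≢b) =
    (x≢y ∘ sym) , (≢a ∘ trans (C-sym x y)) , (≢b ∘ trans (C-sym x y))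

  module Classes {a b : Fin k} {P : List V} (L : Labelling (Off a b) P) where
    open Labelling L public

    apart : ∀ {x y} → lab x ≢ lab y → x ≢ y
    apart ne refl = ne refl

    between : ∀ {x y} → x ∈ P → y ∈ P → lab x ≢ lab y → C x y ≡ a ⊎ C x y ≡ b
    between {x} {y} x∈ y∈ ne with C x y ≟ a | C x y ≟ b
    ... | yes p | _     = inj₁ p
    ... | no _  | yes q = inj₂ q
    ... | no p  | no q  = contradiction (joins x∈ y∈ (apart ne , p , q)) ne

    on-between : ∀ {x y u w} → x ∈ P → y ∈ P → lab x ≢ lab y → Off a b u w → C u w ≢ C x y
    on-between x∈ y∈ ne (_ , ≢a , ≢b) eq with between x∈ y∈ ne
    ... | inj₁ p = ≢a (trans eq p)
    ... | inj₂ p = ≢b (trans eq p)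

    -- For an `Off` edge `u w` inside the class of `x`, the triangle with `y` forces
    -- `C u y ≡ C w y`, because `u w` cannot repeat a colour that occurs between classes. The test
    -- `f` first checks membership in the class, so that it is constant along edges elsewhere too.
    homogeneous : ∀ {x x′ y} → x ∈ P → x′ ∈ P → y ∈ P → lab x ≡ lab x′ → lab x ≢ lab y →
                  C x y ≡ C x′ y
    homogeneous {x} {x′} {y} x∈ x′∈ y∈ same ne with C x′ y ≟ C x y
    ... | yes p = sym p
    ... | no p  = contradiction
                    (trans (sym f-x) (trans (connected x∈ x′∈ same f respects) f-x′)) λ ()
      where
      f : V → Bool
      f u = does (lab u ≟ lab x) ∧ does (C u y ≟ C x y)

      f-x : f x ≡ true
      f-x rewrite dec-true (lab x ≟ lab x) refl | dec-true (C x y ≟ C x y) refl = refl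

      f-x′ : f x′ ≡ false
      f-x′ rewrite dec-true (lab x′ ≟ lab x) (sym same) | dec-false (C x′ y ≟ C x y) p = refl

      step : ∀ {u w} → u ∈ P → w ∈ P → lab u ≡ lab w → Off a b u w → lab u ≡ lab x → C u y ≡ C w y
      step {u} {w} u∈ w∈ e off e′ with C y u ≟ C y w
      ... | yes q = trans (C-sym u y) (trans q (C-sym y w))
      ... | no q  = ⊥-elim (absurd (triangle (apart u≢ ∘ sym) (apart w≢ ∘ sym) (proj₁ off) q))
        where
        u≢ : lab u ≢ lab y
        u≢ = ne ∘ trans (sym e′)
        w≢ : lab w ≢ lab y
        w≢ = u≢ ∘ trans e
        absurd : C u w ≡ C y u ⊎ C u w ≡ C y w → ⊥
        absurd (inj₁ r) = on-between y∈ u∈ (u≢ ∘ sym) off r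
        absurd (inj₂ r) = on-between y∈ w∈ (w≢ ∘ sym) off r

      respects : ∀ {u w} → u ∈ P → w ∈ P → Off a b u w → f u ≡ f w
      respects {u} {w} u∈ w∈ off = by (lab u ≟ lab x)
        where
        e : lab u ≡ lab w
        e = joins u∈ w∈ off
        by : Dec (lab u ≡ lab x) → f u ≡ f w
        by (yes e′) = cong₂ (λ l i → does (l ≟ lab x) ∧ does (i ≟ C x y)) e (step u∈ w∈ e off e′)
        by (no e′) rewrite dec-false (lab u ≟ lab x) e′
                         | dec-false (lab w ≟ lab x) (e′ ∘ trans e) = refl

  -- The constant colour between two parts is supplied by `homogeneous`; `x` and `y` witness that
  -- there are at least two parts.
  record Partition (P : List V) : Set where
    field
      a b : Fin k
      a≢b : a ≢ b
      lbl : Labelling (Off a b) P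
    open Classes lbl public
    field
      {x y} : V
      x∈P   : x ∈ P
      y∈P   : y ∈ P
      x≁y   : lab x ≢ lab y

  -- No `Off` edge leaves `v`, so the indicator of `v` respects the graph and separates `v` from
  -- `w`.
  isolated : ∀ {a b v w P} → Unique (v ∷ P) → w ∈ P → a ≢ b →
             (∀ {u} → u ∈ P → C v u ≡ a ⊎ C v u ≡ b) → Partition (v ∷ P)
  isolated {a} {b} {v} {w} {P} vP! w∈P a≢b v-ab = record
    { a≢b = a≢b ; lbl = L ; x∈P = here refl ; y∈P = there w∈P ; x≁y = sep }
    where
    L = labelling (off? a b) off-sym (v ∷ P) vP!
    open Labelling L

    v≢ : ∀ {u} → u ∈ P → v ≢ u
    v≢ = All.lookup (AllPairs.head vP!)

    is-v : V → Bool
    is-v u = does (u ≟ v)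

    not-off : ∀ {u} → u ∈ P → ¬ Off a b v u
    not-off u∈ (_ , ≢a , ≢b) with v-ab u∈
    ... | inj₁ p = ≢a p
    ... | inj₂ p = ≢b p

    respects : ∀ {u u′} → u ∈ v ∷ P → u′ ∈ v ∷ P → Off a b u u′ → is-v u ≡ is-v u′
    respects (here refl) (here refl) _   = refl
    respects (here refl) (there u′∈) off = contradiction off (not-off u′∈)
    respects (there u∈)  (here refl) off = contradiction (off-sym off) (not-off u∈)
    respects {u} {u′} (there u∈) (there u′∈) _
      rewrite dec-false (u ≟ v) (v≢ u∈ ∘ sym) | dec-false (u′ ≟ v) (v≢ u′∈ ∘ sym) = refl

    sep : lab v ≢ lab w
    sep e = contradiction
      (trans (sym (dec-true (v ≟ v) refl))
        (trans (connected (here refl) (there w∈P) e is-v respects)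
          (dec-false (w ≟ v) (v≢ w∈P ∘ sym)))) λ ()

  -- Either the partition of P survives the addition of v, or v reaches every
  -- class of P through one and the same third colour c; then v sees only c and one
  -- of a, b, so that {v} is a class of its own for these two colours.
  extend : ∀ {v P} → Unique (v ∷ P) → Partition P → Partition (v ∷ P)
  extend {v} {P} vP! Π with any? (λ u → ¬? (lab⁺ v ≟ lab⁺ u)) P
    where
    open Partition Π
    open Labelling (labelling (off? a b) off-sym (v ∷ P) vP!) using () renaming (lab to lab⁺)
  ... | yes t = let u , u∈ , ne = find t in record
    { a≢b = a≢b ; lbl = labelling (off? a b) off-sym (v ∷ P) vP!
    ; x∈P = here refl ; y∈P = there u∈ ; x≁y = ne }
    where open Partition Π
  ... | no none = by (any? (λ u → C v u ≟ b) P)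
    where
    open Partition Π
    open Labelling (labelling (off? a b) off-sym (v ∷ P) vP!) using ()
      renaming (lab to lab⁺; connected to connected⁺)

    v≢ : ∀ {u} → u ∈ P → v ≢ u
    v≢ = All.lookup (AllPairs.head vP!)

    all-one : ∀ {u} → u ∈ P → lab⁺ v ≡ lab⁺ u
    all-one {u} u∈ with lab⁺ v ≟ lab⁺ u
    ... | yes e = e
    ... | no ne = contradiction (lose u∈ ne) none

    Link : V → Set
    Link u = ∃ λ z → z ∈ P × Off a b v z × lab z ≡ lab u

    -- Otherwise the indicator of the class of `u` would respect the graph enlarged by `v`, although
    -- `v` and `u` are connected there.
    link : ∀ {u} → u ∈ P → Link u
    link {u} u∈ with any? (λ z → off? a b v z ×-dec (lab z ≟ lab u)) P
    ... | yes t = find t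
    ... | no unlinked = contradiction
      (trans (sym f-v) (trans (connected⁺ (here refl) (there u∈) (all-one u∈) f respects) f-u)) λ ()
      where
      f : V → Bool
      f w = does (¬? (w ≟ v) ×-dec (lab w ≟ lab u))

      f-v : f v ≡ false
      f-v rewrite dec-true (v ≟ v) refl = refl

      f-old : ∀ {w} → w ∈ P → f w ≡ does (lab w ≟ lab u)
      f-old {w} w∈ rewrite dec-false (w ≟ v) (v≢ w∈ ∘ sym) = refl

      f-u : f u ≡ true
      f-u = trans (f-old u∈) (dec-true (lab u ≟ lab u) refl)

      f-linked : ∀ {w} → w ∈ P → Off a b v w → f w ≡ false
      f-linked {w} w∈ off = trans (f-old w∈)
        (dec-false (lab w ≟ lab u) λ e → unlinked (lose w∈ (off , e)))

      respects : ∀ {w w′} → w ∈ v ∷ P → w′ ∈ v ∷ P → Off a b w w′ → f w ≡ f w′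
      respects (here refl) (here refl) _   = refl
      respects (here refl) (there w′∈) off = trans f-v (sym (f-linked w′∈ off))
      respects (there w∈)  (here refl) off = trans (f-linked w∈ (off-sym off)) (sym f-v)
      respects (there w∈) (there w′∈) off  =
        trans (f-old w∈) (trans (cong (λ l → does (l ≟ lab u)) (joins w∈ w′∈ off)) (sym (f-old w′∈)))

    -- Otherwise `u w` would repeat the colour of one of the two `Off` edges, but it runs between
    -- classes.
    same-colour : ∀ {u w} → u ∈ P → w ∈ P → lab u ≢ lab w → Off a b v u → Off a b v w →
                  C v u ≡ C v w
    same-colour {u} {w} u∈ w∈ ne off off′ with C v u ≟ C v w
    ... | yes e = e
    ... | no e with triangle (v≢ u∈) (v≢ w∈) (apart ne) e
    ...   | inj₁ p = contradiction (sym p) (on-between u∈ w∈ ne off)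
    ...   | inj₂ p = contradiction (sym p) (on-between u∈ w∈ ne off′)

    -- The edges `v u` and `v z` differ in colour, so `u z` repeats one of them; the colour of `v z`
    -- cannot occur between classes.
    transfer : ∀ {u z} → u ∈ P → z ∈ P → lab u ≢ lab z → ¬ Off a b v u → Off a b v z →
               C u z ≡ C v u
    transfer {u} {z} u∈ z∈ ne on off
      with triangle (v≢ u∈) (v≢ z∈) (apart ne) (λ e → on (v≢ u∈ ,
             proj₁ (proj₂ off) ∘ trans (sym e) , proj₂ (proj₂ off) ∘ trans (sym e)))
    ... | inj₁ p = p
    ... | inj₂ p = contradiction (sym p) (on-between u∈ z∈ ne off)

    other-class : ∀ u → ∃ λ w → w ∈ P × lab u ≢ lab w
    other-class u with lab u ≟ lab x
    ... | no ne = x , x∈P , ne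
    ... | yes e = y , y∈P , x≁y ∘ trans (sym e)

    third : Fin k
    third = C v (proj₁ (link x∈P))

    third-off : third ≢ a × third ≢ b
    third-off = proj₂ (proj₁ (proj₂ (proj₂ (link x∈P))))

    off⇒third : ∀ {u} → u ∈ P → Off a b v u → C v u ≡ third
    off⇒third {u} u∈ off with link x∈P | link y∈P
    ... | z , z∈ , offz , ez | z′ , z′∈ , offz′ , ez′ with lab u ≟ lab z
    ...   | no ne = same-colour u∈ z∈ ne off offz
    -- Here `u` shares the class of `z`; since `z′` lies in another one, both are compared with
    -- `z′`.
    ...   | yes e = trans (same-colour u∈ z′∈ (z≁z′ ∘ trans (sym e)) off offz′)
                          (sym (same-colour z∈ z′∈ z≁z′ offz offz′))
      where
      z≁z′ : lab z ≢ lab z′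
      z≁z′ e′ = x≁y (trans (sym ez) (trans e′ ez′))

    -- If `u` and `w` share a class, a link `z` in another class gives `u z` colour `a` and `w z`
    -- colour `b` by `transfer`, against homogeneity. If not, links in both classes force colour `a`
    -- as well as colour `b` on the edge between `u` and `w`.
    not-both : ∀ {u w} → u ∈ P → w ∈ P → C v u ≡ a → C v w ≡ b → ⊥
    not-both {u} {w} u∈ w∈ p q with lab u ≟ lab w
    ... | yes e = let t , t∈ , ne = other-class u
                      z , z∈ , off , ez = link t∈
                      u≁z = λ e′ → ne (trans e′ ez)
                      w≁z = u≁z ∘ trans e
                  in a≢b (trans (sym p) (trans (sym (transfer u∈ z∈ u≁z (λ o → proj₁ (proj₂ o) p) off))
                       (trans (homogeneous u∈ w∈ z∈ e u≁z)
                       (trans (transfer w∈ z∈ w≁z (λ o → proj₂ (proj₂ o) q) off) q))))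
    ... | no ne = let z , z∈ , off , ez = link u∈
                      z′ , z′∈ , off′ , ez′ = link w∈
                      u≁z′ = λ e → ne (trans e ez′)
                      w≁z = λ e → ne (sym (trans e ez))
                      uz′ = trans (transfer u∈ z′∈ u≁z′ (λ o → proj₁ (proj₂ o) p) off′) p
                      wz = trans (transfer w∈ z∈ w≁z (λ o → proj₂ (proj₂ o) q) off) q
                      wu = trans (homogeneous w∈ z′∈ u∈ (sym ez′) (ne ∘ sym)) (trans (C-sym z′ u) uz′)
                      uw = trans (homogeneous u∈ z∈ w∈ (sym ez) ne) (trans (C-sym z w) wz)
                  in a≢b (trans (sym wu) (trans (C-sym w u) uw))

    by : Dec (Any (λ u → C v u ≡ b) P) → Partition (v ∷ P)
    by (yes t) = isolated vP! x∈P (proj₂ third-off ∘ sym) λ u∈ → sees-b u∈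
      where
      sees-b : ∀ {u} → u ∈ P → C v u ≡ b ⊎ C v u ≡ third
      sees-b {u} u∈ with C v u ≟ b | C v u ≟ a
      ... | yes p | _     = inj₁ p
      ... | no _  | yes q = let w , w∈ , r = find t in ⊥-elim (not-both u∈ w∈ q r)
      ... | no p  | no q  = inj₂ (off⇒third u∈ (v≢ u∈ , q , p))
    by (no t) = isolated vP! x∈P (proj₁ third-off ∘ sym) λ u∈ → sees-a u∈
      where
      sees-a : ∀ {u} → u ∈ P → C v u ≡ a ⊎ C v u ≡ third
      sees-a {u} u∈ with C v u ≟ a
      ... | yes p = inj₁ p
      ... | no p  = inj₂ (off⇒third u∈ (v≢ u∈ , p , λ q → t (lose u∈ q)))

  -- Gallai's theorem, by adding one vertex at a time. Two vertices are partitioned by the colour of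
  -- their edge and any second colour, taken from `other`.
  partition : (∀ (i : Fin k) → ∃ λ j → i ≢ j) → ∀ {P} → Unique P → 2 ≤ length P → Partition P
  partition _ {_ ∷ []} _ (s≤s ())
  partition other {v ∷ w ∷ []} P! _ =
    isolated P! (here refl) (proj₂ (other (C v w))) λ { (here refl) → inj₁ refl }
  partition other {v ∷ w ∷ z ∷ P} P! _ =
    extend P! (partition other (AllPairs.tail P!) (s≤s (s≤s z≤n)))

-- Colourings without monochromatic fans

alternate : {A : Set} → ℕ → List A → List A → List A
alternate zero    _        _  = []
alternate (suc j) []       _  = []
alternate (suc j) (x ∷ xs) ys = x ∷ alternate j ys xs

alternate-length : {A : Set} → ∀ j (xs ys : List A) → j ≤ length xs → j ≤ length ys →
                   length (alternate j xs ys) ≡ j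
alternate-length zero    _        _  _       _ = refl
alternate-length (suc j) (x ∷ xs) ys (s≤s p) q = cong suc (alternate-length j ys xs (<⇒≤ q) p)

alternate-∈ : {A : Set} → ∀ j (xs ys : List A) {z} → z ∈ alternate j xs ys → z ∈ xs ⊎ z ∈ ys
alternate-∈ (suc j) (x ∷ xs) ys (here e)  = inj₁ (here e)
alternate-∈ (suc j) (x ∷ xs) ys (there p) with alternate-∈ j ys xs p
... | inj₁ r = inj₂ r
... | inj₂ r = inj₁ (there r)

module _ {m k : ℕ} (c : Colouring m k) where

  -- Since `Edge` includes `x ≢ y`, joined lists are automatically disjoint.
  Joined : Fin k → List (Fin m) → List (Fin m) → Set
  Joined i xs ys = ∀ {x y} → x ∈ xs → y ∈ ys → Edge c i x y

  edge-sym : ∀ {i x y} → Edge c i x y → Edge c i y x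
  edge-sym {x = x} {y} (ne , e) = ne ∘ sym , trans (symm c y x) e

  joined-sym : ∀ {i xs ys} → Joined i xs ys → Joined i ys xs
  joined-sym j p q = edge-sym (j q p)

  alternate-path : ∀ {i} j {xs ys} → Joined i xs ys → Unique xs → Unique ys →
                   Linked (Edge c i) (alternate j xs ys) × Unique (alternate j xs ys)
  alternate-path zero _ _ _ = [] , []
  alternate-path (suc j) {[]} _ _ _ = [] , []
  alternate-path {i} (suc j) {x ∷ xs} {ys} joined (x∉ ∷ xs!) ys!
    with alternate-path j {ys} {xs} (λ p q → edge-sym (joined (there q) p)) ys! xs!
  ... | linked , unique = cons j ys joined linked , All.tabulate fresh ∷ unique
    where
    cons : ∀ j ys → Joined i (x ∷ xs) ys → Linked (Edge c i) (alternate j ys xs) →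
           Linked (Edge c i) (x ∷ alternate j ys xs)
    cons zero    _        _      _ = [-]
    cons (suc j) []       _      _ = [-]
    cons (suc j) (y ∷ ys) joined l = joined (here refl) (here refl) ∷ l

    fresh : ∀ {z} → z ∈ alternate j ys xs → x ≢ z
    fresh z∈ with alternate-∈ j ys xs z∈
    ... | inj₁ z∈ys = proj₁ (joined (here refl) z∈ys)
    ... | inj₂ z∈xs = All.lookup x∉ z∈xs

  module NoFan (q : ℕ) (1≤q : 1 ≤ q) (noFan : ¬ Fan c q) where

    bipartite⇒no-edge : ∀ {i x y xs ys} → Unique xs → Unique ys → q ≤ length xs → q ≤ length ys →
      Joined i xs ys → Joined i (x ∷ y ∷ []) xs → Joined i (x ∷ y ∷ []) ys → ¬ Edge c i x y
    bipartite⇒no-edge {i} {x} {y} {xs} {ys} xs! ys! q≤xs q≤ys xs-ys xy-xs xy-ys xy =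
      noFan (i , x , y , alternate q xs ys , alternate-length q xs ys q≤xs q≤ys , xy ,
        All.tabulate (hub (here refl)) , All.tabulate (hub (there (here refl))) ,
        alternate-path q xs-ys xs! ys!)
      where
      hub : ∀ {u z} → u ∈ x ∷ y ∷ [] → z ∈ alternate q xs ys → Edge c i u z
      hub u∈ z∈ with alternate-∈ q xs ys z∈
      ... | inj₁ z∈xs = xy-xs u∈ z∈xs
      ... | inj₂ z∈ys = xy-ys u∈ z∈ys

    no-clique : ∀ {i K} → length K ≡ 2 + q → ¬ AllPairs (Edge c i) K
    no-clique {i} {x ∷ y ∷ ys} len ((xy ∷ x-ys) ∷ y-ys ∷ ys-clique) =
      noFan (i , x , y , ys , suc-injective (suc-injective len) , xy , x-ys , y-ys ,
        AllPairs⇒Linked ys-clique , AllPairs.map proj₁ ys-clique)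

    PathFree : Fin k → List (Fin m) → Set
    PathFree i A = ∀ {ys} → length ys ≡ q → Linked (Edge c i) ys → Unique ys → All (_∈ A) ys → ⊥

    nbrs : Fin k → Fin m → List (Fin m) → List (Fin m)
    nbrs i w A = filter (edge? c i w) A

    -- A path grows greedily at its head, and `r` counts the vertices it lacks. While it has fewer
    -- than `q` vertices, a head with at least `q` neighbours has one off the path; as a path on `q`
    -- vertices is excluded, some head has low degree.
    low-degree : ∀ {i A w} → Unique A → w ∈ A → PathFree i A →
                 ∃ λ u → u ∈ A × length (nbrs i u A) < q
    low-degree {i} {A} {w} A! w∈A no-path =
      grow (q ∸ 1) w [] (m+[n∸m]≡n 1≤q) [-] ([] ∷ []) (w∈A ∷ [])
      where
      grow : ∀ r u us → suc (length us) + r ≡ q → Linked (Edge c i) (u ∷ us) → Unique (u ∷ us) →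
             All (_∈ A) (u ∷ us) → ∃ λ u → u ∈ A × length (nbrs i u A) < q
      grow zero u us len path path! inA =
        ⊥-elim (no-path (trans (sym (+-identityʳ _)) len) path path! inA)
      grow (suc r) u us len path path! inA@(u∈A ∷ _) with length (nbrs i u A) <? q
      ... | yes low = u , u∈A , low
      ... | no high with any? (λ z → ¬? (any? (z ≟_) (u ∷ us))) (nbrs i u A)
      ...   | yes t = let z , z∈N , z∉path = find t
                          z∈A , uz = ∈-filter⁻ (edge? c i u) z∈N
                      in grow r z (u ∷ us) (trans (sym (+-suc _ r)) len) (edge-sym uz ∷ path)
                           (All.tabulate (λ { z∈ refl → z∉path z∈ }) ∷ path!) (z∈A ∷ inA)
      ...   | no t = contradiction (≤-<-trans (unique-⊆⇒length≤ (filter⁺ (edge? c i u) A!) N⊆path)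
                       (subst (suc (length us) <_) len (m<m+n (suc (length us)) (s≤s z≤n)))) high
        where
        N⊆path : ∀ {z} → z ∈ nbrs i u A → z ∈ u ∷ us
        N⊆path {z} z∈N with any? (z ≟_) (u ∷ us)
        ... | yes p = p
        ... | no p  = contradiction (lose z∈N p) t

    -- Two-coloured complete multipartite graphs with parts of size at most q

    -- `M` pays for a clique on `2 + q` vertices at a cost of `q + q` each. A step from `t` to
    -- `q + (t + t)` sets aside a vertex's own part and leaves it `t` neighbours in one of the two
    -- colours.
    M M₁ M₂ M₃ : ℕ
    M  = (2 + q) * (q + q)
    M₁ = q + (M + M)
    M₂ = q + (M₁ + M₁)
    M₃ = q + (M₂ + M₂)

    module SmallParts {a b : Fin k} {P : List (Fin m)} (lab : Fin m → Fin m) (P! : Unique P)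
      (between : ∀ {x y} → x ∈ P → y ∈ P → lab x ≢ lab y → col c x y ≡ a ⊎ col c x y ≡ b)
      (small : ∀ {x} → x ∈ P → length (filter (λ y → lab x ≟ lab y) P) ≤ q) where

      Opposite : Fin k → Fin k → Set
      Opposite e e′ = (e ≡ a × e′ ≡ b) ⊎ (e ≡ b × e′ ≡ a)

      split : ∀ {e e′} → Opposite e e′ → ∀ {A w} → Unique A → (∀ {x} → x ∈ A → x ∈ P) → w ∈ A →
              length A ≤ q + (length (nbrs e w A) + length (nbrs e′ w A))
      split {e} {e′} opp {A} {w} A! A⊆P w∈A = ≤-trans
        (length≤-cover same? (edge? c e w) (edge? c e′ w) A! cover)
        (+-monoˡ-≤ _ (≤-trans (unique-⊆⇒length≤ (filter⁺ same? A!) same⊆) (small (A⊆P w∈A))))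
        where
        same? : ∀ y → Dec (lab w ≡ lab y)
        same? y = lab w ≟ lab y

        same⊆ : ∀ {x} → x ∈ filter same? A → x ∈ filter same? P
        same⊆ x∈ = let x∈A , s = ∈-filter⁻ same? x∈ in ∈-filter⁺ same? (A⊆P x∈A) s

        either : ∀ {i e e′ : Fin k} → Opposite e e′ → i ≡ a ⊎ i ≡ b → i ≡ e ⊎ i ≡ e′
        either (inj₁ (refl , refl)) p        = p
        either (inj₂ (refl , refl)) (inj₁ p) = inj₂ p
        either (inj₂ (refl , refl)) (inj₂ p) = inj₁ p

        cover : ∀ {y} → y ∈ A → lab w ≡ lab y ⊎ Edge c e w y ⊎ Edge c e′ w y
        cover {y} y∈A with lab w ≟ lab y
        ... | yes s = inj₁ s
        ... | no ne with either opp (between (A⊆P w∈A) (A⊆P y∈A) ne)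
        ...   | inj₁ p = inj₂ (inj₁ ((λ { refl → ne refl }) , p))
        ...   | inj₂ p = inj₂ (inj₂ ((λ { refl → ne refl }) , p))

      nonempty : ∀ {j} {A : List (Fin m)} → 1 ≤ j → j ≤ length A → ∃ (_∈ A)
      nonempty {A = x ∷ A} _ _ = x , here refl
      nonempty {A = []} p r = contradiction (≤-trans p r) λ ()

      -- A vertex of low degree in colour `e` loses fewer than `q` vertices to that colour and at
      -- most `q` to its own part. All others are its neighbours in colour `e′`, where the search
      -- continues.
      clique : ∀ {e e′} → Opposite e e′ → ∀ j {A} → Unique A → (∀ {x} → x ∈ A → x ∈ P) →
               j * (q + q) ≤ length A → PathFree e A →
               ∃ λ K → length K ≡ j × AllPairs (Edge c e′) K × (∀ {x} → x ∈ K → x ∈ A)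
      clique _ zero _ _ _ _ = [] , refl , [] , λ ()
      clique {e} {e′} opp (suc j) {A} A! A⊆P large no-path =
        let w₀ , w₀∈A = nonempty (≤-trans 1≤q (≤-trans (m≤m+n q q) (m≤m+n (q + q) _))) large
            w , w∈A , low = low-degree A! w₀∈A no-path
            B = nbrs e′ w A
            B⊆A : ∀ {x} → x ∈ B → x ∈ A
            B⊆A x∈ = proj₁ (∈-filter⁻ (edge? c e′ w) x∈)
            large′ : j * (q + q) ≤ length B
            large′ = +-cancelˡ-≤ (q + q) _ _ (begin
              (q + q) + j * (q + q)                ≤⟨ large ⟩
              length A                             ≤⟨ split opp A! A⊆P w∈A ⟩
              q + (length (nbrs e w A) + length B) ≤⟨ +-monoʳ-≤ q (+-monoˡ-≤ _ (<⇒≤ low)) ⟩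
              q + (q + length B)                   ≡⟨ sym (+-assoc q q _) ⟩
              (q + q) + length B                   ∎)
            K , len , K-clique , K⊆B = clique opp j (filter⁺ (edge? c e′ w) A!) (A⊆P ∘ B⊆A) large′
              (λ len l u inB → no-path len l u (All.map B⊆A inB))
        in w ∷ K , cong suc len ,
           All.tabulate (λ x∈ → proj₂ (∈-filter⁻ (edge? c e′ w) {xs = A} (K⊆B x∈))) ∷ K-clique ,
           λ { (here refl) → w∈A ; (there x∈) → B⊆A (K⊆B x∈) }
        where open ≤-Reasoning

      -- A path on `q` vertices of `A` in colour `e` would form a fan with `w w′`. So `A` is
      -- path-free in `e`, and `clique` yields what `no-clique` forbids in the opposite colour.
      no-two-hubs : ∀ {e w w′ A} → e ≡ a ⊎ e ≡ b → Edge c e w w′ → Unique A →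
        (∀ {x} → x ∈ A → x ∈ P) → M ≤ length A → Joined e (w ∷ w′ ∷ []) A → ⊥
      no-two-hubs {e} {w} {w′} {A} e-ab ww′ A! A⊆P large hubs = by (opposite e-ab)
        where
        opposite : e ≡ a ⊎ e ≡ b → ∃ (Opposite e)
        opposite (inj₁ p) = b , inj₁ (p , refl)
        opposite (inj₂ p) = a , inj₂ (p , refl)

        no-path : PathFree e A
        no-path {ys} len path ys! inA = noFan (e , w , w′ , ys , len , ww′ ,
          All.map (hubs (here refl)) inA , All.map (hubs (there (here refl))) inA , path , ys!)

        by : ∃ (Opposite e) → ⊥
        by (e′ , opp) = conclude (clique opp (2 + q) A! A⊆P large no-path)
          where
          conclude : (∃ λ K → length K ≡ 2 + q × AllPairs (Edge c e′) K ×
                        (∀ {x} → x ∈ K → x ∈ A)) → ⊥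
          conclude (K , len , K-clique , _) = no-clique len K-clique

      record Majority (A : List (Fin m)) (t : ℕ) : Set where
        field
          w    : Fin m
          w∈A  : w ∈ A
          e    : Fin k
          e-ab : e ≡ a ⊎ e ≡ b
          N    : List (Fin m)
          N!   : Unique N
          N⊆A  : ∀ {x} → x ∈ N → x ∈ A
          t≤N  : t ≤ length N
          hub  : ∀ {x} → x ∈ N → Edge c e w x

      majority : ∀ {A} t → Unique A → (∀ {x} → x ∈ A → x ∈ P) → q + (t + t) ≤ length A →
                 Majority A t
      majority {A} t A! A⊆P large with nonempty (≤-trans 1≤q (m≤m+n q (t + t))) large
      ... | w , w∈A with t ≤? length (nbrs a w A) | t ≤? length (nbrs b w A)
      ...   | yes p | _ = record
        { w∈A = w∈A ; e-ab = inj₁ refl ; N! = filter⁺ (edge? c a w) A! ; t≤N = p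
        ; N⊆A = λ x∈ → proj₁ (∈-filter⁻ (edge? c a w) x∈)
        ; hub = λ x∈ → proj₂ (∈-filter⁻ (edge? c a w) {xs = A} x∈) }
      ...   | no _ | yes p = record
        { w∈A = w∈A ; e-ab = inj₂ refl ; N! = filter⁺ (edge? c b w) A! ; t≤N = p
        ; N⊆A = λ x∈ → proj₁ (∈-filter⁻ (edge? c b w) x∈)
        ; hub = λ x∈ → proj₂ (∈-filter⁻ (edge? c b w) {xs = A} x∈) }
      ...   | no p | no r = contradiction large (<⇒≱ (≤-<-trans (split (inj₁ (refl , refl)) A! A⊆P w∈A)
                              (+-monoʳ-< q (+-mono-< (≰⇒> p) (≰⇒> r)))))

      -- Three rounds of `majority` repeat one of two colours, and the last neighbourhood still has
      -- the `M` vertices that `no-two-hubs` asks for.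
      size≤ : length P ≤ M₃
      size≤ with M₃ ≤? length P
      ... | no p  = <⇒≤ (≰⇒> p)
      ... | yes p = ⊥-elim (pigeonhole (m₁.e ≟ m₂.e) (m₁.e ≟ m₃.e))
        where
        m₁ = majority M₂ P! (λ x∈ → x∈) p
        module m₁ = Majority m₁
        m₂ = majority M₁ m₁.N! m₁.N⊆A m₁.t≤N
        module m₂ = Majority m₂
        m₃ = majority M m₂.N! (m₁.N⊆A ∘ m₂.N⊆A) m₂.t≤N
        module m₃ = Majority m₃

        hubs : ∀ {e e′ w w′} → e ≡ e′ → e ≡ a ⊎ e ≡ b → Edge c e w w′ →
               (∀ {x} → x ∈ m₃.N → Edge c e w x) → (∀ {x} → x ∈ m₃.N → Edge c e′ w′ x) → ⊥
        hubs refl e-ab ww′ w-N w′-N = no-two-hubs e-ab ww′ m₃.N! (m₁.N⊆A ∘ m₂.N⊆A ∘ m₃.N⊆A) m₃.t≤N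
          λ { (here refl) → w-N ; (there (here refl)) → w′-N }

        third-equal : ∀ {e₁ e₂ e₃ : Fin k} → e₁ ≡ a ⊎ e₁ ≡ b → e₂ ≡ a ⊎ e₂ ≡ b → e₃ ≡ a ⊎ e₃ ≡ b →
                      e₁ ≢ e₂ → e₁ ≢ e₃ → e₂ ≡ e₃
        third-equal (inj₁ refl) (inj₁ refl) _ n _ = contradiction refl n
        third-equal (inj₁ refl) (inj₂ refl) (inj₁ refl) _ n = contradiction refl n
        third-equal (inj₁ refl) (inj₂ refl) (inj₂ refl) _ _ = refl
        third-equal (inj₂ refl) (inj₂ refl) _ n _ = contradiction refl n
        third-equal (inj₂ refl) (inj₁ refl) (inj₂ refl) _ n = contradiction refl n
        third-equal (inj₂ refl) (inj₁ refl) (inj₁ refl) _ _ = refl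

        pigeonhole : Dec (m₁.e ≡ m₂.e) → Dec (m₁.e ≡ m₃.e) → ⊥
        pigeonhole (yes p) _ = hubs p m₁.e-ab
          (m₁.hub m₂.w∈A) (m₁.hub ∘ m₂.N⊆A ∘ m₃.N⊆A) (m₂.hub ∘ m₃.N⊆A)
        pigeonhole (no _) (yes p) = hubs p m₁.e-ab
          (m₁.hub (m₂.N⊆A m₃.w∈A)) (m₁.hub ∘ m₂.N⊆A ∘ m₃.N⊆A) m₃.hub
        pigeonhole (no p) (no r) = hubs (third-equal m₁.e-ab m₂.e-ab m₃.e-ab p r) m₂.e-ab
          (m₂.hub m₃.w∈A) (m₂.hub ∘ m₃.N⊆A) m₃.hub

    -- Reserves

    Reserve : Set
    Reserve = List (Fin m) × List (Fin m)

    record Attached (i : Fin k) (S : Reserve) (P : List (Fin m)) : Set where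
      constructor attached
      field
        unique₁ : Unique (proj₁ S)
        unique₂ : Unique (proj₂ S)
        cross   : Joined i (proj₁ S) (proj₂ S)
        joined₁ : Joined i (proj₁ S) P
        joined₂ : Joined i (proj₂ S) P

    restrict : ∀ {i S P P′} → (∀ {x} → x ∈ P′ → x ∈ P) → Attached i S P → Attached i S P′
    restrict P′⊆P (attached u₁ u₂ cr j₁ j₂) =
      attached u₁ u₂ cr (λ p r → j₁ p (P′⊆P r)) (λ p r → j₂ p (P′⊆P r))

    swap-attached : ∀ {i X Y P} → Attached i (X , Y) P → Attached i (Y , X) P
    swap-attached (attached u₁ u₂ cr j₁ j₂) = attached u₂ u₁ (joined-sym cr) j₂ j₁

    full⇒no-edge : ∀ {i X Y P x y} → Attached i (X , Y) P → ¬ length X < q → ¬ length Y < q →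
                   x ∈ P → y ∈ P → ¬ Edge c i x y
    full⇒no-edge {x = x} {y} att X≮q Y≮q x∈P y∈P =
      bipartite⇒no-edge unique₁ unique₂ (≮⇒≥ X≮q) (≮⇒≥ Y≮q) cross (hubs joined₁) (hubs joined₂)
      where
      open Attached att
      hubs : ∀ {i Z} → Joined i Z _ → Joined i (x ∷ y ∷ []) Z
      hubs j (here refl)         z∈ = edge-sym (j z∈ x∈P)
      hubs j (there (here refl)) z∈ = edge-sym (j z∈ y∈P)

    short : ℕ → ℕ
    short l = if does (l <? q) then 1 else 0

    -- Summed over all colours these are the quantities L and T.
    level room : Reserve → ℕ
    level (X , Y) = short (length X) + short (length Y)
    room  (X , Y) = (q ∸ length X) + (q ∸ length Y)

    -- The effect of adding d vertices to a reserve: it takes up room, or lowers the level.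
    Change : ℕ → ℕ → ℕ → ℕ → ℕ → Set
    Change d lev room lev′ room′ =
      (d < q × lev′ ≡ lev × room′ + d ≡ room) ⊎ (suc lev′ ≡ lev × room′ ≤ room)

    short-< : ∀ {l} → l < q → short l ≡ 1
    short-< {l} p = cong (if_then 1 else 0) (dec-true (l <? q) p)

    short-≮ : ∀ {l} → ¬ l < q → short l ≡ 0
    short-≮ {l} p = cong (if_then 1 else 0) (dec-false (l <? q) p)

    change : ∀ l d → l < q → Change d (short l) (q ∸ l) (short (l + d)) (q ∸ (l + d))
    change l d l<q with l + d <? q
    ... | yes p = inj₁ (≤-<-trans (m≤n+m d l) p , trans (short-< p) (sym (short-< l<q)) ,
                    trans (cong (_+ d) (sym (∸-+-assoc q l d))) (m∸n+n≡m d≤q∸l))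
      where
      d≤q∸l : d ≤ q ∸ l
      d≤q∸l = m+n≤o⇒m≤o∸n d (subst (_≤ q) (+-comm l d) (<⇒≤ p))
    ... | no p = inj₂ (trans (cong suc (short-≮ p)) (sym (short-< l<q)) , ∸-monoʳ-≤ q (m≤m+n l d))

    change-+ : ∀ {d lev room lev′ room′} x y → Change d lev room lev′ room′ →
               Change d (lev + x) (room + y) (lev′ + x) (room′ + y)
    change-+ {d} {room′ = room′} x y (inj₁ (d<q , e , r)) =
      inj₁ (d<q , cong (_+ x) e , trans (lemma room′ y d) (cong (_+ y) r))
      where
      lemma : ∀ r y d → r + y + d ≡ r + d + y
      lemma = solve-∀
    change-+ x y (inj₂ (e , r)) = inj₂ (cong (_+ x) e , +-monoˡ-≤ y r)

    +-change : ∀ {d lev room lev′ room′} x y → Change d lev room lev′ room′ →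
               Change d (x + lev) (y + room) (x + lev′) (y + room′)
    +-change {d} {room′ = room′} x y (inj₁ (d<q , e , r)) =
      inj₁ (d<q , cong (x +_) e , trans (+-assoc y room′ d) (cong (y +_) r))
    +-change {lev′ = lev′} x y (inj₂ (e , r)) =
      inj₂ (trans (sym (+-suc x lev′)) (cong (x +_) e) , +-monoʳ-≤ y r)

    ResChange : List (Fin m) → Reserve → Reserve → Set
    ResChange D S S′ = Change (length D) (level S) (room S) (level S′) (room S′)

    -- As a subset of `P`, the list `D` is already joined to both `X` and `Y`: the former makes it
    -- disjoint from `X`, the latter gives the new cross edges.
    append : ∀ {i X Y P P′ D} → Attached i (X , Y) P → Unique D → (∀ {x} → x ∈ D → x ∈ P) →
             (∀ {x} → x ∈ P′ → x ∈ P) → Joined i D P′ → Attached i (X ++ D , Y) P′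
    append {X = X} (attached u₁ u₂ cr j₁ j₂) D! D⊆P P′⊆P D-P′ = attached
      (++⁺ u₁ D! λ (p , r) → proj₁ (j₁ p (D⊆P r)) refl) u₂ cross′ joined′ (λ p r → j₂ p (P′⊆P r))
      where
      cross′ : Joined _ (X ++ _) _
      cross′ p r with ∈-++⁻ X p
      ... | inj₁ p′ = cr p′ r
      ... | inj₂ p′ = edge-sym (j₂ r (D⊆P p′))
      joined′ : Joined _ (X ++ _) _
      joined′ p r with ∈-++⁻ X p
      ... | inj₁ p′ = j₁ p′ (P′⊆P r)
      ... | inj₂ p′ = D-P′ p′ r

    -- If both lists were full, a vertex of `D` and the vertex `x` of `P′` would span an edge of
    -- colour `i` inside `P`, against `full⇒no-edge`. An empty `D` is the trivial case of taking up
    -- no room.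
    absorb : ∀ {i S P P′ D x} → Attached i S P → Unique D → (∀ {x} → x ∈ D → x ∈ P) →
             (∀ {x} → x ∈ P′ → x ∈ P) → Joined i D P′ → x ∈ P′ →
             ∃ λ S′ → Attached i S′ P′ × ResChange D S S′
    absorb {S = S} {D = []} att _ _ P′⊆P _ _ =
      S , restrict P′⊆P att , inj₁ (1≤q , refl , +-identityʳ (room S))
    absorb {S = X , Y} {D = D@(_ ∷ _)} att D! D⊆P P′⊆P D-P′ x∈P′
      with length X <? q | length Y <? q
    ... | yes X<q | _ = (X ++ D , Y) , append att D! D⊆P P′⊆P D-P′ ,
      subst (λ l → Change (length D) _ _ (short l + _) ((q ∸ l) + _)) (sym (length-++ X))
        (change-+ (short (length Y)) (q ∸ length Y) (change (length X) (length D) X<q))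
    ... | no _ | yes Y<q = (X , Y ++ D) , swap-attached (append (swap-attached att) D! D⊆P P′⊆P D-P′) ,
      subst (λ l → Change (length D) _ _ (_ + short l) (_ + (q ∸ l))) (sym (length-++ Y))
        (+-change (short (length X)) (q ∸ length X) (change (length Y) (length D) Y<q))
    ... | no X≮q | no Y≮q = contradiction (D-P′ (here refl) x∈P′)
      (full⇒no-edge att X≮q Y≮q (D⊆P (here refl)) (P′⊆P x∈P′))

    State : Set
    State = Fin k → Reserve

    Level Room : State → ℕ
    Level st = sum (level ∘ st)
    Room  st = sum (room ∘ st)

    _[_≔_] : State → Fin k → Reserve → State
    (st [ i ≔ S ]) j = if does (i ≟ j) then S else st j

    set-same : ∀ st i S → (st [ i ≔ S ]) i ≡ S
    set-same st i S rewrite dec-true (i ≟ i) refl = refl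

    set-other : ∀ st {i j} S → i ≢ j → (st [ i ≔ S ]) j ≡ st j
    set-other st {i} {j} S ne rewrite dec-false (i ≟ j) ne = refl

    change-sum : ∀ st i S {D} → ResChange D (st i) S →
                 Change (length D) (Level st) (Room st) (Level (st [ i ≔ S ])) (Room (st [ i ≔ S ]))
    change-sum st i S {D} = λ where
        (inj₁ (D<q , e , r)) → inj₁ (D<q , +-cancelʳ-≡ (level S) _ _ (trans (cong (Level st′ +_) e) lev) ,
          +-cancelʳ-≡ (room S) _ _ (trans (lemma (Room st′) (length D) (room S))
            (trans (cong (Room st′ +_) r) rm)))
        (inj₂ (e , r)) → inj₂ (+-cancelʳ-≡ (level S) _ _
          (trans (sym (+-suc (Level st′) (level S))) (trans (cong (Level st′ +_) e) lev)) ,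
          +-cancelʳ-≤ (room (st i)) _ _ (≤-trans (≤-reflexive rm) (+-monoʳ-≤ (Room st) r)))
      where
      st′ : State
      st′ = st [ i ≔ S ]

      lemma : ∀ x y z → x + y + z ≡ x + (z + y)
      lemma = solve-∀

      lev : Level st′ + level (st i) ≡ Level st + level S
      lev = trans (sum-change (level ∘ st′) (level ∘ st) i λ j ne → cong level (set-other st S ne))
                  (cong (λ T → Level st + level T) (set-same st i S))

      rm : Room st′ + room (st i) ≡ Room st + room S
      rm = trans (sum-change (room ∘ st′) (room ∘ st) i λ j ne → cong room (set-other st S ne))
                 (cong (λ T → Room st + room T) (set-same st i S))

    -- Only the reserve of colour `i` must be attached to the larger `P` that contains `D`; for the
    -- others `P′` is enough. Hence two feeds with different colours can follow each other.
    feed : ∀ st {i P P′ D x} → (∀ j → Attached j (st j) P′) → Attached i (st i) P → Unique D →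
           (∀ {x} → x ∈ D → x ∈ P) → (∀ {x} → x ∈ P′ → x ∈ P) → Joined i D P′ → x ∈ P′ →
           ∃ λ st′ → (∀ j → Attached j (st′ j) P′) × (∀ {j} → i ≢ j → st′ j ≡ st j) ×
             Change (length D) (Level st) (Room st) (Level st′) (Room st′)
    feed st {i} {P′ = P′} {D} atts att D! D⊆P P′⊆P D-P′ x∈P′ with absorb att D! D⊆P P′⊆P D-P′ x∈P′
    ... | S , att′ , ch = st [ i ≔ S ] , atts′ , set-other st S , change-sum st i S {D} ch
      where
      atts′ : ∀ j → Attached j ((st [ i ≔ S ]) j) P′
      atts′ j with i ≟ j
      ... | yes refl = att′
      ... | no _     = atts j

    short-room : ∀ l → q ∸ l ≤ q * short l
    short-room l with l <? q
    ... | yes p = ≤-trans (m∸n≤m q l) (≤-reflexive (sym (trans (cong (q *_) (short-< p)) (*-identityʳ q))))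
    ... | no p  = ≤-trans (≤-reflexive (m≤n⇒m∸n≡0 (≮⇒≥ p))) z≤n

    sum-room : ∀ {k} (st : Fin k → Reserve) → sum (room ∘ st) ≤ q * sum (level ∘ st)
    sum-room {zero}  st = z≤n
    sum-room {suc k} st = begin
      room (st zero) + sum (room ∘ st ∘ suc)           ≤⟨ +-mono-≤ head-room (sum-room (st ∘ suc)) ⟩
      q * level (st zero) + q * sum (level ∘ st ∘ suc) ≡⟨ sym (*-distribˡ-+ q (level (st zero)) _) ⟩
      q * (level (st zero) + sum (level ∘ st ∘ suc))   ∎
      where
      open ≤-Reasoning
      X = proj₁ (st zero)
      Y = proj₂ (st zero)
      head-room : room (st zero) ≤ q * level (st zero)
      head-room = ≤-trans (+-mono-≤ (short-room (length X)) (short-room (length Y)))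
        (≤-reflexive (sym (*-distribˡ-+ q (short (length X)) _)))

    -- Gives a positive exponent when all parts are small, so that a bound by `3 * A` suffices
    -- there.
    edge⇒level : ∀ {i S P x y} → Attached i S P → x ∈ P → y ∈ P → Edge c i x y → 1 ≤ level S
    edge⇒level {S = X , Y} att x∈P y∈P xy with length X <? q | length Y <? q
    ... | yes p | _     = ≤-trans (≤-reflexive (sym (short-< p))) (m≤m+n _ _)
    ... | no _  | yes p = ≤-trans (≤-reflexive (sym (short-< p))) (m≤n+m _ (short (length X)))
    ... | no X≮q | no Y≮q = contradiction xy (full⇒no-edge att X≮q Y≮q x∈P y∈P)

    -- The induction on the size of the vertex set.

    module Bound (noRainbow : ¬ RainbowK3 c) (other : ∀ (i : Fin k) → ∃ λ j → i ≢ j)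
                 (A : ℕ) (M₃≤3A : M₃ ≤ 3 * A) (2q≤A : q * 2 ≤ A) where

      module G = Gallai c noRainbow

      -- `A` stands for 36 d². The assumption `M₃≤3A` serves the case of small parts, and `2q≤A`
      -- lets the exponential term dominate the room.
      cap : State → ℕ
      cap st = A * 3 ^ Level st + Room st

      1≤A : 1 ≤ A
      1≤A = ≤-trans 1≤q (≤-trans (m≤m*n q 2) 2q≤A)

      2+j≤2*3^j : ∀ j → 2 + j ≤ 2 * 3 ^ j
      2+j≤2*3^j zero    = ≤-refl
      2+j≤2*3^j (suc j) = begin
        1 + (2 + j)             ≤⟨ +-mono-≤ (≤-trans (m^n>0 3 j) (m≤n*m (3 ^ j) 4)) (2+j≤2*3^j j) ⟩
        4 * 3 ^ j + 2 * 3 ^ j   ≡⟨ lemma (3 ^ j) ⟩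
        2 * (3 * 3 ^ j)         ∎
        where
        open ≤-Reasoning
        lemma : ∀ x → 4 * x + 2 * x ≡ 2 * (3 * x)
        lemma = solve-∀

      -- At most `Level st` lists are short, each lacking at most `q` elements. This supplies the
      -- hypothesis `R ≤ X` of `drop-one` and `drop-two`.
      room-small : ∀ st {j} → Level st ≤ 2 + j → Room st ≤ A * 3 ^ j
      room-small st {j} lev = begin
        Room st         ≤⟨ sum-room st ⟩
        q * Level st    ≤⟨ *-monoʳ-≤ q (≤-trans lev (2+j≤2*3^j j)) ⟩
        q * (2 * 3 ^ j) ≡⟨ sym (*-assoc q 2 _) ⟩
        q * 2 * 3 ^ j   ≤⟨ *-monoˡ-≤ (3 ^ j) 2q≤A ⟩
        A * 3 ^ j       ∎
        where open ≤-Reasoning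

      -- Exactly one neighbourhood, of size `s`, lowers the level, and `X` is the exponential term
      -- one level down. The size `t` of the other is paid for by the room it takes; the third `X`
      -- pays for the second `R`.
      drop-one : ∀ {v s t X R R′} → v ≤ X + R′ → R′ + t ≤ R → s ≤ X + R → R ≤ X →
                 v + (s + t) ≤ 3 * X + R
      drop-one {v} {s} {t} {X} {R} {R′} v≤ t≤ s≤ R≤X = begin
        v + (s + t)                ≤⟨ +-mono-≤ v≤ (+-monoˡ-≤ t s≤) ⟩
        X + R′ + (X + R + t)       ≡⟨ lemma X R R′ t ⟩
        X + X + (R′ + t) + R       ≤⟨ +-monoˡ-≤ R (+-monoʳ-≤ (X + X) (≤-trans t≤ R≤X)) ⟩
        X + X + X + R              ≡⟨ lemma′ X R ⟩
        3 * X + R                  ∎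
        where
        open ≤-Reasoning
        lemma : ∀ X R R′ t → X + R′ + (X + R + t) ≡ X + X + (R′ + t) + R
        lemma = solve-∀
        lemma′ : ∀ X R → X + X + X + R ≡ 3 * X + R
        lemma′ = solve-∀

      -- Both neighbourhoods lower the level, and `X` is the exponential term two levels down. The
      -- sum is at most `7 * X + 3 * R`, and the spare `2 * X` pays for two of the three `R`.
      drop-two : ∀ {v s t X R R′} → v ≤ X + R′ → R′ ≤ R → s ≤ 3 * X + R → t ≤ 3 * X + R → R ≤ X →
                 v + (s + t) ≤ 9 * X + R
      drop-two {v} {s} {t} {X} {R} {R′} v≤ R′≤ s≤ t≤ R≤X = begin
        v + (s + t)                              ≤⟨ +-mono-≤ (≤-trans v≤ (+-monoʳ-≤ X (≤-trans R′≤ R≤X)))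
                                                      (+-mono-≤ (≤-trans s≤ (+-monoʳ-≤ (3 * X) R≤X)) t≤) ⟩
        X + X + (3 * X + X + (3 * X + R))        ≡⟨ lemma X R ⟩
        9 * X + R                                ∎
        where
        open ≤-Reasoning
        lemma : ∀ X R → X + X + (3 * X + X + (3 * X + R)) ≡ 9 * X + R
        lemma = solve-∀

      triple : ∀ j → 3 * (A * 3 ^ j) ≡ A * 3 ^ suc j
      triple j = lemma A (3 ^ j)
        where
        lemma : ∀ A x → 3 * (A * x) ≡ A * (3 * x)
        lemma = solve-∀

      -- `fuel` makes the recursion structural: `W` misses a vertex because there are at least two
      -- parts, and each `N i` misses `x`. Lists with fewer than two vertices have no partition and
      -- are treated first.
      size≤cap : ∀ fuel {P} → Unique P → length P ≤ fuel → ∀ st → (∀ i → Attached i (st i) P) →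
                 length P ≤ cap st
      size≤cap _ {[]} _ _ _ _ = z≤n
      size≤cap _ {_ ∷ []} _ _ st _ = ≤-trans (*-mono-≤ 1≤A (m^n>0 3 (Level st))) (m≤m+n _ (Room st))
      size≤cap (suc fuel) {P@(x₀ ∷ x₁ ∷ _)} P!@((x₀≢x₁ ∷ _) ∷ _) (s≤s P≤fuel) st atts =
        by (any? (λ x → q ≤? length (class x)) P)
        where
        Π : G.Partition P
        Π = G.partition other P! (s≤s (s≤s z≤n))
        open G.Partition Π using (a; b; a≢b; lab; between; homogeneous; x≁y)
          renaming (y to y₁; x to y₀; x∈P to y₀∈P; y∈P to y₁∈P)

        class : Fin m → List (Fin m)
        class x = filter (λ y → lab x ≟ lab y) P

        by : Dec (Any (λ x → q ≤ length (class x)) P) → length P ≤ cap st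
        by (no none) = begin
          length P          ≤⟨ SmallParts.size≤ lab P! between small ⟩
          M₃                ≤⟨ M₃≤3A ⟩
          3 * A             ≡⟨ *-comm 3 A ⟩
          A * 3 ^ 1         ≤⟨ *-monoʳ-≤ A (^-monoʳ-≤ 3 level≥1) ⟩
          A * 3 ^ Level st  ≤⟨ m≤m+n _ (Room st) ⟩
          cap st            ∎
          where
          open ≤-Reasoning
          small : ∀ {x} → x ∈ P → length (class x) ≤ q
          small {x} x∈ with q ≤? length (class x)
          ... | yes p = contradiction (lose x∈ p) none
          ... | no p  = <⇒≤ (≰⇒> p)
          i = col c x₀ x₁
          level≥1 : 1 ≤ Level st
          level≥1 = ≤-trans (edge⇒level (atts i) (here refl) (there (here refl)) (x₀≢x₁ , refl))
                            (≤-sum (level ∘ st) i)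
        by (yes t) with find t
        ... | x , x∈P , q≤W = ≤-trans covered combine
          where
          W : List (Fin m)
          W = class x

          beyond? : ∀ i y → Dec (lab x ≢ lab y × col c x y ≡ i)
          beyond? i y = ¬? (lab x ≟ lab y) ×-dec (col c x y ≟ i)

          N : Fin k → List (Fin m)
          N i = filter (beyond? i) P

          same? : ∀ y → Dec (lab x ≡ lab y)
          same? y = lab x ≟ lab y

          covered : length P ≤ length W + (length (N a) + length (N b))
          covered = length≤-cover same? (beyond? a) (beyond? b) P! cover
            where
            cover : ∀ {y} → y ∈ P → lab x ≡ lab y ⊎ (lab x ≢ lab y × col c x y ≡ a)
                                                  ⊎ (lab x ≢ lab y × col c x y ≡ b)
            cover {y} y∈ with lab x ≟ lab y
            ... | yes s = inj₁ s
            ... | no ne with between x∈P y∈ ne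
            ...   | inj₁ p = inj₂ (inj₁ (ne , p))
            ...   | inj₂ p = inj₂ (inj₂ (ne , p))

          W⊆P : ∀ {y} → y ∈ W → y ∈ P
          W⊆P y∈ = proj₁ (∈-filter⁻ same? y∈)

          N⊆P : ∀ i {y} → y ∈ N i → y ∈ P
          N⊆P i y∈ = proj₁ (∈-filter⁻ (beyond? i) y∈)

          W! : Unique W
          W! = filter⁺ same? P!

          N! : ∀ i → Unique (N i)
          N! i = filter⁺ (beyond? i) P!

          x∈W : x ∈ W
          x∈W = ∈-filter⁺ same? x∈P refl

          W-N : ∀ i → Joined i W (N i)
          W-N i u∈ w∈ with ∈-filter⁻ same? {xs = P} u∈ | ∈-filter⁻ (beyond? i) {xs = P} w∈
          ... | u∈P , s | w∈P , ne , e =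
            (λ { refl → ne s }) , trans (sym (homogeneous x∈P u∈P w∈P s ne)) e

          N-W : ∀ i → Joined i (N i) W
          N-W i = joined-sym (W-N i)

          W≤fuel : length W ≤ fuel
          W≤fuel = ≤-pred (≤-trans (filter-notAll same? P outside) (s≤s P≤fuel))
            where
            outside : Any (λ y → lab x ≢ lab y) P
            outside with lab x ≟ lab y₀
            ... | no ne = lose y₀∈P ne
            ... | yes e = lose y₁∈P (x≁y ∘ trans (sym e))

          N≤fuel : ∀ i → length (N i) ≤ fuel
          N≤fuel i = ≤-pred (≤-trans (filter-notAll (beyond? i) P (lose x∈P λ (ne , _) → ne refl))
                                     (s≤s P≤fuel))

          -- Since `W` has at least `q` elements, feeding it to the reserve of colour `i` cannot
          -- merely take up room and must lower the level. The empty case is separate because `feed`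
          -- needs a vertex of `P′`.
          N≤ : ∀ i {j} → suc j ≡ Level st → length (N i) ≤ A * 3 ^ j + Room st
          N≤ i {j} lev = nonempty (N i) refl
            where
            nonempty : ∀ Z → N i ≡ Z → length Z ≤ A * 3 ^ j + Room st
            nonempty [] _ = z≤n
            nonempty (z ∷ Z) e
              with feed st (λ j → restrict (N⊆P i) (atts j)) (atts i) W! W⊆P (N⊆P i) (W-N i)
                     (subst (z ∈_) (sym e) (here refl))
            ... | _ , _ , _ , inj₁ (W<q , _) = contradiction W<q (≤⇒≯ q≤W)
            ... | st′ , atts′ , _ , inj₂ (lev′ , room′) = begin
              length (z ∷ Z)              ≡⟨ cong length (sym e) ⟩
              length (N i)                ≤⟨ size≤cap fuel (N! i) (N≤fuel i) st′ atts′ ⟩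
              A * 3 ^ Level st′ + Room st′ ≤⟨ +-mono-≤ (≤-reflexive (cong (λ l → A * 3 ^ l)
                                               (suc-injective (trans lev′ (sym lev))))) room′ ⟩
              A * 3 ^ j + Room st         ∎
              where open ≤-Reasoning

          combine : length W + (length (N a) + length (N b)) ≤ cap st
          combine
            with feed st (λ j → restrict W⊆P (atts j)) (atts a) (N! a) (N⊆P a) W⊆P (N-W a) x∈W
          ... | st₁ , atts₁ , same₁ , ch₁
            -- The first feed left the reserve of `b` untouched, so it is still attached to all of
            -- `P`, where `N b` lies.
            with feed st₁ atts₁ (subst (λ S → Attached b S P) (sym (same₁ a≢b)) (atts b))
                   (N! b) (N⊆P b) W⊆P (N-W b) x∈W
          ... | st₂ , atts₂ , _ , ch₂ = finish ch₁ ch₂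
            where
            W≤ : length W ≤ A * 3 ^ Level st₂ + Room st₂
            W≤ = size≤cap fuel W! W≤fuel st₂ atts₂

            total = length W + (length (N a) + length (N b))
            R₁ = Room st₁
            R₂ = Room st₂

            W≤′ : ∀ {j} → Level st₂ ≡ j → length W ≤ A * 3 ^ j + R₂
            W≤′ refl = W≤

            conclude : ∀ {j s} → j ≡ Level st → s ≤ A * 3 ^ j + Room st → s ≤ cap st
            conclude refl p = p

            finish : Change (length (N a)) (Level st) (Room st) (Level st₁) R₁ →
                     Change (length (N b)) (Level st₁) R₁ (Level st₂) R₂ →
                     length W + (length (N a) + length (N b)) ≤ cap st
            -- Neither neighbourhood lowers the level, so the room they take up accounts for both.
            finish (inj₁ (_ , l₁ , r₁)) (inj₁ (_ , l₂ , r₂)) = begin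
              length W + (na + nb)         ≤⟨ +-monoˡ-≤ _ (W≤′ (trans l₂ l₁)) ⟩
              X + R₂ + (na + nb)           ≡⟨ lemma X R₂ na nb ⟩
              X + (R₂ + nb + na)           ≡⟨ cong (λ r → X + (r + na)) r₂ ⟩
              X + (R₁ + na)                ≡⟨ cong (X +_) r₁ ⟩
              cap st                       ∎
              where
              open ≤-Reasoning
              X = A * 3 ^ Level st
              na = length (N a)
              nb = length (N b)
              lemma : ∀ X R s t → X + R + (s + t) ≡ X + (R + t + s)
              lemma = solve-∀
            finish (inj₂ (l₁ , r₁)) (inj₁ (_ , l₂ , r₂)) = conclude l₁
              (subst (λ z → total ≤ z + Room st) (triple (Level st₁))
                (drop-one {length W} {length (N a)} {length (N b)} (W≤′ l₂) (≤-trans (≤-reflexive r₂) r₁) (N≤ a l₁)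
                  (room-small st (≤-trans (≤-reflexive (sym l₁)) (n≤1+n _)))))
            finish (inj₁ (_ , l₁ , r₁)) (inj₂ (l₂ , r₂)) = conclude (trans l₂ l₁)
              (subst (λ z → total ≤ z + Room st) (triple (Level st₂))
                (subst (_≤ 3 * (A * 3 ^ Level st₂) + Room st) (cong (length W +_) (+-comm (length (N b)) (length (N a))))
                  (drop-one {length W} {length (N b)} {length (N a)} W≤ (≤-trans (+-monoˡ-≤ _ r₂) (≤-reflexive r₁)) (N≤ b (trans l₂ l₁))
                    (room-small st (≤-trans (≤-reflexive (sym (trans l₂ l₁))) (n≤1+n _))))))
            finish (inj₂ (l₁ , r₁)) (inj₂ (l₂ , r₂)) = conclude two
              (subst (λ z → total ≤ z + Room st) nine
                (drop-two {length W} {length (N a)} {length (N b)} W≤ (≤-trans r₂ r₁) (N≤′ a) (N≤′ b) (room-small st (≤-reflexive (sym two)))))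
              where
              X = A * 3 ^ Level st₂
              two : 2 + Level st₂ ≡ Level st
              two = trans (cong suc l₂) l₁
              N≤′ : ∀ i → length (N i) ≤ 3 * X + Room st
              N≤′ i = subst (λ z → length (N i) ≤ z + Room st) (sym (triple (Level st₂))) (N≤ i two)
              nine : 9 * X ≡ A * 3 ^ (2 + Level st₂)
              nine = trans (*-assoc 3 3 X) (trans (cong (3 *_) (triple (Level st₂))) (triple (suc (Level st₂))))

-- Numerical estimates.

n<9^n : ∀ n → n < 9 ^ n
n<9^n zero    = s≤s z≤n
n<9^n (suc n) = ≤-trans (+-mono-≤ (m^n>0 9 n) (n<9^n n)) (+-monoʳ-≤ (9 ^ n) (m≤m+n (9 ^ n) _))

-- The base case is 26973 ≤ 27000. Beyond the factor 36 of `cap` there is one spare copy of d² · 9^k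
-- for the linear terms.
37*9^n≤30^n : ∀ j → 37 * 9 ^ (3 + j) ≤ 30 ^ (3 + j)
37*9^n≤30^n zero    = from-yes (37 * 9 ^ 3 ≤? 30 ^ 3)
37*9^n≤30^n (suc j) = begin
  37 * (9 * 9 ^ (3 + j)) ≡⟨ lemma (9 ^ (3 + j)) ⟩
  9 * (37 * 9 ^ (3 + j)) ≤⟨ *-mono-≤ (from-yes (9 ≤? 30)) (37*9^n≤30^n j) ⟩
  30 * 30 ^ (3 + j)      ∎
  where
  open ≤-Reasoning
  lemma : ∀ x → 37 * (9 * x) ≡ 9 * (37 * x)
  lemma = solve-∀

-- Of 2kq = k(d + 1) + k(d + 3), the second summand is the claimed k(n - 1). The first is below d² ·
-- 9^k, because d + 1 ≤ d² for d ≥ 2 and k < 9^k.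
cap<N : ∀ k d → 3 ≤ k → 2 ≤ d →
        36 * d ^ 2 * 3 ^ (k * 2) + k * (2 + d + (2 + d)) < d ^ 2 * 30 ^ k + k * (3 + d)
cap<N (suc (suc (suc j))) d@(suc (suc e)) (s≤s (s≤s (s≤s _))) (s≤s (s≤s _)) = begin-strict
  36 * D * 3 ^ (k * 2) + k * (2 + d + (2 + d))     ≡⟨ cong (λ x → 36 * D * x + k * (2 + d + (2 + d))) 3^2k ⟩
  36 * D * Y + k * (2 + d + (2 + d))               ≡⟨ lemma D Y k d ⟩
  36 * D * Y + k * (1 + d) + k * (3 + d)           <⟨ +-monoˡ-< (k * (3 + d)) (+-monoʳ-< (36 * D * Y) k[1+d]<DY) ⟩
  36 * D * Y + D * Y + k * (3 + d)                 ≡⟨ cong (_+ k * (3 + d)) (lemma′ D Y) ⟩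
  D * (37 * Y) + k * (3 + d)                       ≤⟨ +-monoˡ-≤ (k * (3 + d)) (*-monoʳ-≤ D (37*9^n≤30^n j)) ⟩
  D * 30 ^ k + k * (3 + d)                         ∎
  where
  open ≤-Reasoning
  k = 3 + j
  D = d ^ 2
  Y = 9 ^ k

  3^2k : 3 ^ (k * 2) ≡ 9 ^ k
  3^2k = trans (cong (3 ^_) (*-comm k 2)) (sym (^-*-assoc 3 2 k))

  lemma : ∀ D Y k d → 36 * D * Y + k * (2 + d + (2 + d)) ≡ 36 * D * Y + k * (1 + d) + k * (3 + d)
  lemma = solve-∀

  lemma′ : ∀ D Y → 36 * D * Y + D * Y ≡ D * (37 * Y)
  lemma′ = solve-∀

  1+d≤D : 1 + d ≤ D
  1+d≤D = subst (1 + d ≤_) (sym (square e)) (m≤m+n (1 + d) (1 + e * 3 + e * e))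
    where
    square : ∀ e → (2 + e) * ((2 + e) * 1) ≡ 1 + (2 + e) + (1 + e * 3 + e * e)
    square = solve-∀

  k[1+d]<DY : k * (1 + d) < D * Y
  k[1+d]<DY = begin-strict
    k * (1 + d) ≤⟨ *-monoʳ-≤ k 1+d≤D ⟩
    k * D       <⟨ *-monoˡ-< D (n<9^n k) ⟩
    Y * D       ≡⟨ *-comm Y D ⟩
    D * Y       ∎

-- The bound for the whole vertex set, starting from empty reserves.

theorem9 : ∀ (k n : ℕ) → 3 ≤ k → 6 ≤ n →
    GR-K3-Wheel-≤ k n (((n ∸ 4) ^ 2) * (30 ^ k) + k * (n ∸ 1))
theorem9 k@(suc (suc _)) (suc (suc (suc (suc d@(suc (suc e))))))
         3≤k@(s≤s (s≤s _)) (s≤s (s≤s (s≤s (s≤s (s≤s (s≤s _)))))) m N≤m c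
  with Fin.any? (λ x → Fin.any? λ y → Fin.any? λ z →
         ¬? (x ≟ y) ×-dec (¬? (y ≟ z) ×-dec (¬? (x ≟ z) ×-dec
         (¬? (col c x y ≟ col c y z) ×-dec (¬? (col c x y ≟ col c x z) ×-dec
         ¬? (col c y z ≟ col c x z))))))
     | fan? c (2 + d)
... | yes rainbow  | _       = inj₁ rainbow
... | no _         | yes fan = inj₂ (fan⇒wheel c (s≤s z≤n) fan)
... | no noRainbow | no noFan = contradiction (≤-trans N≤m m≤) (<⇒≱ (cap<N k d 3≤k (s≤s (s≤s z≤n))))
  where
  open NoFan c (2 + d) (s≤s z≤n) noFan

  other : ∀ (i : Fin k) → ∃ λ j → i ≢ j
  other zero    = suc zero , λ ()
  other (suc i) = zero , λ ()

  -- Here M₃ = 16 q² + 39 q with q = e + 4 and d = e + 2; the difference from 108 d² has only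
  -- positive coefficients in e.
  M₃≤ : M₃ ≤ 3 * (36 * d ^ 2)
  M₃≤ = subst (M₃ ≤_) (sym (lemma e)) (m≤m+n M₃ (20 + 265 * e + 92 * (e * e)))
    where
    lemma : ∀ e → let d = 2 + e; q = 2 + d; M = (2 + q) * (q + q); M₁ = q + (M + M); M₂ = q + (M₁ + M₁) in
            3 * (36 * (d * (d * 1))) ≡ q + (M₂ + M₂) + (20 + 265 * e + 92 * (e * e))
    lemma = solve-∀

  2q≤ : (2 + d) * 2 ≤ 36 * d ^ 2
  2q≤ = subst ((2 + d) * 2 ≤_) (sym (lemma e)) (m≤m+n ((2 + d) * 2) (136 + 142 * e + 36 * (e * e)))
    where
    lemma : ∀ e → 36 * ((2 + e) * ((2 + e) * 1)) ≡ (2 + (2 + e)) * 2 + (136 + 142 * e + 36 * (e * e))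
    lemma = solve-∀

  open Bound noRainbow other (36 * d ^ 2) M₃≤ 2q≤

  m≤ : m ≤ 36 * d ^ 2 * 3 ^ (k * 2) + k * (2 + d + (2 + d))
  m≤ = begin
    m                   ≡⟨ sym (length-tabulate {n = m} (λ x → x)) ⟩
    length (allFin m)   ≤⟨ size≤cap (length (allFin m)) (allFin⁺ m) ≤-refl (λ _ → [] , [])
                             (λ _ → attached [] [] (λ ()) (λ ()) (λ ())) ⟩
    cap (λ _ → [] , []) ≡⟨ cong₂ (λ l r → 36 * d ^ 2 * 3 ^ l + r) (sum-const k 2) (sum-const k (2 + d + (2 + d))) ⟩
    36 * d ^ 2 * 3 ^ (k * 2) + k * (2 + d + (2 + d)) ∎
    where open ≤-Reasoning
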